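{- For all integers $t\ge2$ and $n\ge18t^6$, $f(n,t)\ge\frac{12}{5}t^3$.
   Context: All graphs are finite and simple. $\mathcal{G}_3(n)$ denotes the family of tripartite graphs with $n$ vertices in each of the three parts (each part is an independent set). $\delta(G)$ is the minimum degree of $G$ and $\tau(G)$ is the number of triangles in $G$. For integers $1\le t\le n$, \[ f(n,t)=\min\{\tau(G): G\in\mathcal{G}_3(n),\ \delta(G)\ge n+t\}. \] -}

module Defs where

open import Data.Bool.Base using (Bool; true; false; T; not; _∧_)
open import Data.Bool.Properties using (T-∧; T?; ∧-comm)
open import Data.Fin.Base as Fin
  using (Fin; zero; suc; combine; quotient; remQuot; _↑ˡ_; _↑ʳ_)
open import Data.Fin.Properties as Fin
  using (_≟_; remQuot-combine; splitAt-↑ˡ; splitAt-↑ʳ)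
open import Data.Fin.Subset using (Subset; ∣_∣)
open import Data.Fin.Subset.Properties using (anySubset?)
open import Data.List.Base using (List; length; map; filter; allFin; cartesianProduct)
open import Data.List.Extrema.Nat using (min; v≤min⁺)
open import Data.List.Properties using (filter-≐; map-cong)
open import Data.List.Relation.Unary.All as All using ()
import Data.List.Relation.Unary.All.Properties as All
open import Data.Nat.Base using (ℕ; zero; suc; _+_; _*_; _≤_; z≤n; s≤s)
open import Data.Nat.Properties as ℕ using (_≤?_)
open import Data.Product using (∃; _×_; _,_; proj₁; proj₂)
open import Data.Vec.Base using (tabulate; lookup)
open import Data.Vec.Properties using (tabulate-cong; lookup∘tabulate)
open import Function.Base using (_∘_)
open import Function.Bundles using (module Equivalence)
open import Level using (0ℓ)
open import Relation.Binary.Definitions using (Symmetric; Irreflexive)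
open import Relation.Binary.PropositionalEquality
open import Relation.Nullary using (yes; no; does; contradiction)
open import Relation.Nullary.Decidable using (_×-dec_; map′)
open import Relation.Unary using (Pred; Decidable)

record Graph (N : ℕ) : Set where
  field
    adj : Fin N → Fin N → Bool

  infix 4 _~_
  _~_ : Fin N → Fin N → Set
  u ~ v = T (adj u v)

  field
    ~-sym    : Symmetric _~_
    ~-irrefl : Irreflexive _≡_ _~_

module _ {N : ℕ} (G : Graph N) where
  open Graph G

  neighbours : Fin N → Subset N
  neighbours v = tabulate (adj v)

  degree : Fin N → ℕ
  degree v = ∣ neighbours v ∣

  -- Every degree is less than N when N > 0, so the default value N of the
  -- list minimum does not affect the minimum degree of a nonempty graph.
  δ : ℕ
  δ = min N (map degree (allFin N))

  -- The vertices of a triangle are listed in increasing order, so that each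
  -- triangle is counted once.
  IsTriangle : Fin N × Fin N × Fin N → Set
  IsTriangle (u , v , w) = (u Fin.< v × v Fin.< w) × (u ~ v × v ~ w × u ~ w)

  isTriangle? : Decidable IsTriangle
  isTriangle? (u , v , w) =
    (u Fin.<? v ×-dec v Fin.<? w) ×-dec
    (T? (adj u v) ×-dec T? (adj v w) ×-dec T? (adj u w))

  triangles : List (Fin N × Fin N × Fin N)
  triangles =
    filter isTriangle? (cartesianProduct (allFin N) (cartesianProduct (allFin N) (allFin N)))

  τ : ℕ
  τ = length triangles

-- The vertex set Fin (3 * n) is cut into three consecutive blocks of n
-- vertices; part v is the index of the block containing v.
part : ∀ {n} → Fin (3 * n) → Fin 3
part {n} = quotient n

record 𝒢₃ (n : ℕ) : Set where
  field
    graph : Graph (3 * n)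
  open Graph graph public
  field
    independent : ∀ {u v} → u ~ v → part {n} u ≢ part {n} v

open 𝒢₃ using (graph)

IsMinTriangleCount : (n t m : ℕ) → Set
IsMinTriangleCount n t m =
  (∃ λ (G : 𝒢₃ n) → n + t ≤ δ (graph G) × τ (graph G) ≡ m) ×
  (∀ (G : 𝒢₃ n) → n + t ≤ δ (graph G) → m ≤ τ (graph G))

private
  module _ {N : ℕ} (G H : Graph N) (eq : ∀ u v → Graph.adj G u v ≡ Graph.adj H u v) where

    δ-cong : δ G ≡ δ H
    δ-cong = cong (min N) (map-cong (λ v → cong ∣_∣ (tabulate-cong (eq v))) (allFin N))

    τ-cong : τ G ≡ τ H
    τ-cong = cong length (filter-≐ (isTriangle? G) (isTriangle? H) (to , from) triples)
      where
      triples : List (Fin N × Fin N × Fin N)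
      triples = cartesianProduct (allFin N) (cartesianProduct (allFin N) (allFin N))

      to : ∀ {x} → IsTriangle G x → IsTriangle H x
      to {u , v , w} (o , a , b , c) =
        o , subst T (eq u v) a , subst T (eq v w) b , subst T (eq u w) c

      from : ∀ {x} → IsTriangle H x → IsTriangle G x
      from {u , v , w} (o , a , b , c) =
        o , subst T (sym (eq u v)) a , subst T (sym (eq v w)) b , subst T (sym (eq u w)) c

  module _ {n : ℕ} where

    cross : Fin (3 * n) → Fin (3 * n) → Bool
    cross u v = not (does (part {n} u ≟ part {n} v))

    cross⇒≢ : ∀ u v → T (cross u v) → part {n} u ≢ part {n} v
    cross⇒≢ u v c with part {n} u ≟ part {n} v
    ... | no ¬p = ¬p

    ≢⇒cross : ∀ u v → part {n} u ≢ part {n} v → T (cross u v)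
    ≢⇒cross u v ¬p with part {n} u ≟ part {n} v
    ... | yes p = contradiction p ¬p
    ... | no  _ = _

    -- An arbitrary Boolean matrix is turned into a tripartite graph by keeping
    -- the symmetric pairs of entries that join different parts.
    fromMatrix : (Fin (3 * n) → Fin (3 * n) → Bool) → 𝒢₃ n
    fromMatrix M = record
      { graph = record
        { adj      = λ u v → cross u v ∧ (M u v ∧ M v u)
        ; ~-sym    = λ {u} {v} e → Equivalence.from T-∧
            ( ≢⇒cross v u (≢-sym (cross⇒≢ u v (proj₁ (Equivalence.to T-∧ e))))
            , subst T (∧-comm (M u v) (M v u)) (proj₂ (Equivalence.to (T-∧ {cross u v}) e)) )
        ; ~-irrefl = λ { {u} refl e → cross⇒≢ u u (proj₁ (Equivalence.to T-∧ e)) refl }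
        }
      ; independent = λ {u} {v} e → cross⇒≢ u v (proj₁ (Equivalence.to T-∧ e))
      }

    fromSubset : Subset (3 * n * (3 * n)) → 𝒢₃ n
    fromSubset S = fromMatrix (λ u v → lookup S (combine u v))

    toSubset : 𝒢₃ n → Subset (3 * n * (3 * n))
    toSubset G = tabulate (λ i → 𝒢₃.adj G (quotient (3 * n) i) (proj₂ (remQuot {3 * n} (3 * n) i)))

    lookup-toSubset : ∀ G u v → lookup (toSubset G) (combine u v) ≡ 𝒢₃.adj G u v
    lookup-toSubset G u v = trans
      (lookup∘tabulate _ (combine u v))
      (cong (λ p → 𝒢₃.adj G (proj₁ p) (proj₂ p)) (remQuot-combine u v))

    T-ext : ∀ {a b} → (T a → T b) → (T b → T a) → a ≡ b
    T-ext {true}  {true}  _ _ = refl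
    T-ext {false} {false} _ _ = refl
    T-ext {true}  {false} f _ = contradiction (f _) λ ()
    T-ext {false} {true}  _ g = contradiction (g _) λ ()

    fromSubset-toSubset : ∀ G u v → 𝒢₃.adj (fromSubset (toSubset G)) u v ≡ 𝒢₃.adj G u v
    fromSubset-toSubset G u v
      rewrite lookup-toSubset G u v | lookup-toSubset G v u = T-ext
        (λ e → proj₁ (Equivalence.to T-∧ (proj₂ (Equivalence.to (T-∧ {cross u v}) e))))
        (λ e → Equivalence.from T-∧
          (≢⇒cross u v (𝒢₃.independent G e) , Equivalence.from T-∧ (e , 𝒢₃.~-sym G e)))

    Attained : ℕ → ℕ → Set
    Attained t m = ∃ λ (G : 𝒢₃ n) → n + t ≤ δ (graph G) × τ (graph G) ≡ m

    attained? : ∀ t → Decidable (Attained t)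
    attained? t m = map′
      (λ (S , p) → fromSubset S , p)
      (λ (G , d , e) → toSubset G
        , subst (n + t ≤_) (sym (δ-cong (graph (fromSubset (toSubset G))) (graph G) (fromSubset-toSubset G))) d
        , trans (τ-cong (graph (fromSubset (toSubset G))) (graph G) (fromSubset-toSubset G)) e)
      (anySubset? λ S → (n + t ≤? δ (graph (fromSubset S))) ×-dec (τ (graph (fromSubset S)) ℕ.≟ m))

    complete : 𝒢₃ n
    complete = fromMatrix (λ _ _ → true)

  least : ∀ {P : Pred ℕ 0ℓ} → Decidable P → ∀ {k} → P k → ∃ λ m → P m × (∀ {j} → P j → m ≤ j)
  least P? {zero} p = zero , p , λ _ → z≤n
  least P? {suc k} p with P? zero
  ... | yes p₀ = zero , p₀ , λ _ → z≤n
  ... | no ¬p₀ with least (P? ∘ suc) {k} p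
  ...   | m , q , below = suc m , q , λ { {zero} r → contradiction r ¬p₀ ; {suc j} r → s≤s (below r) }

  ∣tabulate∣-+ : ∀ a {b} (g : Fin (a + b) → Bool) →
    ∣ tabulate g ∣ ≡ ∣ tabulate (g ∘ (_↑ˡ b)) ∣ + ∣ tabulate (g ∘ (a ↑ʳ_)) ∣
  ∣tabulate∣-+ zero    g = refl
  ∣tabulate∣-+ (suc a) g with g zero
  ... | true  = cong suc (∣tabulate∣-+ a (g ∘ suc))
  ... | false = ∣tabulate∣-+ a (g ∘ suc)

  ∣tabulate-const∣ : ∀ n b → ∣ tabulate {n = n} (λ _ → b) ∣ ≡ ∣ tabulate {n = 1} (λ _ → b) ∣ * n
  ∣tabulate-const∣ zero    true  = refl
  ∣tabulate-const∣ zero    false = refl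
  ∣tabulate-const∣ (suc n) true  = cong suc (∣tabulate-const∣ n true)
  ∣tabulate-const∣ (suc n) false = ∣tabulate-const∣ n false

  ∣tabulate-quotient∣ : ∀ k n (h : Fin k → Bool) →
    ∣ tabulate (h ∘ quotient {k} n) ∣ ≡ ∣ tabulate h ∣ * n
  ∣tabulate-quotient∣ zero    n h = refl
  ∣tabulate-quotient∣ (suc k) n h = begin
    ∣ tabulate (h ∘ quotient {suc k} n) ∣
      ≡⟨ ∣tabulate∣-+ n (h ∘ quotient {suc k} n) ⟩
    ∣ tabulate (h ∘ quotient {suc k} n ∘ (_↑ˡ (k * n))) ∣ + ∣ tabulate (h ∘ quotient {suc k} n ∘ (n ↑ʳ_)) ∣
      ≡⟨ cong₂ (λ x y → ∣ x ∣ + ∣ y ∣) (tabulate-cong (cong h ∘ left)) (tabulate-cong (cong h ∘ right)) ⟩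
    ∣ tabulate {n = n} (λ _ → h zero) ∣ + ∣ tabulate (h ∘ suc ∘ quotient {k} n) ∣
      ≡⟨ cong₂ _+_ (∣tabulate-const∣ n (h zero)) (∣tabulate-quotient∣ k n (h ∘ suc)) ⟩
    ∣ tabulate {n = 1} (λ _ → h zero) ∣ * n + ∣ tabulate (h ∘ suc) ∣ * n
      ≡⟨ ℕ.*-distribʳ-+ n ∣ tabulate {n = 1} (λ _ → h zero) ∣ _ ⟨
    (∣ tabulate {n = 1} (λ _ → h zero) ∣ + ∣ tabulate (h ∘ suc) ∣) * n
      ≡⟨ cong (_* n) (∣tabulate∣-+ 1 h) ⟨
    ∣ tabulate h ∣ * n ∎
    where
    open ≡-Reasoning
    left : ∀ i → quotient {suc k} n (i ↑ˡ (k * n)) ≡ zero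
    left i rewrite splitAt-↑ˡ n i (k * n) = refl
    right : ∀ i → quotient {suc k} n (n ↑ʳ i) ≡ suc (quotient {k} n i)
    right i rewrite splitAt-↑ʳ n (k * n) i = refl

  degree-complete : ∀ n v → degree (graph (complete {n})) v ≡ 2 * n
  degree-complete n v = trans
    (∣tabulate-quotient∣ 3 n (λ j → not (does (part {n} v ≟ j)) ∧ true))
    (cong (_* n) (two (part {n} v)))
    where
    two : ∀ (p : Fin 3) → ∣ tabulate (λ j → not (does (p ≟ j)) ∧ true) ∣ ≡ 2
    two zero             = refl
    two (suc zero)       = refl
    two (suc (suc zero)) = refl

  δ-complete : ∀ {n t} → t ≤ n → n + t ≤ δ (graph (complete {n}))
  δ-complete {n} {t} t≤n = v≤min⁺ {⊤ = 3 * n}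
    (ℕ.+-monoʳ-≤ n (ℕ.≤-trans t≤n (ℕ.m≤m+n n _)))
    (All.map⁺ (All.universal (λ v → subst (n + t ≤_) (sym (degree-complete n v)) n+t≤2n) (allFin (3 * n))))
    where
    n+t≤2n : n + t ≤ 2 * n
    n+t≤2n = ℕ.+-monoʳ-≤ n (ℕ.≤-trans t≤n (ℕ.m≤m+n n _))

-- The hypothesis t ≤ n makes the family nonempty: it contains the complete
-- tripartite graph.
minTriangleCount : ∀ {n t} → t ≤ n → ∃ (IsMinTriangleCount n t)
minTriangleCount {n} {t} t≤n with least (attained? {n} t) (complete , δ-complete t≤n , refl)
... | m , attained , below = m , attained , λ G d → below (G , d , refl)

-- The value 0 for t > n, where no graph qualifies, is a convention.
f : ℕ → ℕ → ℕ
f n t with t ≤? n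
... | yes t≤n = proj₁ (minTriangleCount t≤n)
... | no  _   = 0

f-isMin : ∀ {n t} → t ≤ n → IsMinTriangleCount n t (f n t)
f-isMin {n} {t} t≤n with t ≤? n
... | yes t≤n′ = proj₂ (minTriangleCount t≤n′)
... | no  t≰n  = contradiction t≤n t≰n

{-# OPTIONS --safe #-}
module Submission where

-- Orient each edge from part V_i to part V_{i+1}; the reversed cyclic order
-- gives a second orientation.  For a vertex v let q(v) be its out-degree, c(v)
-- the number of vertices of the preceding part not adjacent to v, so that
-- q(v) ≥ t + c(v), and w(v) the number of triangles at v.  An edge v → z lies in
-- at least q(z) ∸ c(v) ≥ t + c(z) ∸ c(v) triangles, and the w(z) of the
-- out-neighbours z of v add up to at most the total number A of triangles.
--
-- Suppose A < 6/5 t³.  In units where t = 1, the first fact gives w ≥ 1 − c²,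
-- hence w ≥ 1 − c.  Averaging this over the out-neighbours of v gives
-- w ≥ 4/5 + c − c², hence w ≥ 1 − 2c/3, and averaging again gives w ≥ 7/10 when
-- c ≤ 3/2.  When c ≥ 3/2, an out-neighbour z of v has w(z) ≥ 7/10 by induction if
-- c(z) < c(v), and v → z lies in at least t triangles otherwise; since v has at
-- least 5/2 out-neighbours, w(v) ≥ 7/10 again.  So every vertex lies in a
-- triangle, which is impossible when n is large.
--
-- This holds for either orientation even if A counts only the triangles all of
-- whose vertices have out-degree O(t³).  Since degrees exceed n, no triangle is
-- counted for both orientations, and the two bounds 6/5 t³ add up.

open import Defs
open import Data.Bool.Base using (Bool; true; false; T; _∧_)
open import Data.Bool.Properties using (T-∧; ∧-assoc; ∧-comm)
open import Data.Fin.Base as Fin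
  using (Fin; zero; suc; quotient; remainder; _↑ˡ_; _↑ʳ_)
open import Data.Fin.Properties
  using (_≟_; combine-monoˡ-<; combine-remQuot; splitAt-↑ˡ; splitAt-↑ʳ)
open import Data.Fin.Subset using (∣_∣)
import Data.Integer.Base as ℤ
import Data.Integer.Properties as ℤ
open import Data.List.Base as List
  using ([]; _∷_; _++_; List; allFin; cartesianProduct; filter; length)
open import Data.List.Extrema.Nat using (min≤xs)
open import Data.List.Properties using (filter-++; length-++)
import Data.List.Relation.Unary.All.Properties as All
open import Data.Nat.Base as ℕ using (ℕ; _^_)
import Data.Nat.Properties as ℕ
open import Data.Nat.Tactic.RingSolver using (solve-∀)
open import Data.Product.Base using (_×_; _,_; proj₁; proj₂)
open import Data.Sum.Base using (_⊎_; inj₁; inj₂)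
open import Data.Vec.Base using (tabulate)
open import Function.Base using (_∘_; flip; id)
open import Function.Bundles using (module Equivalence)
open import Level using (0ℓ)
open import Relation.Binary.PropositionalEquality
open import Relation.Nullary using (contradiction; does; yes)
open import Relation.Nullary.Decidable using (dec-true)
open import Relation.Unary using (Decidable; Pred)

open 𝒢₃ using (graph)

module _ where

  open import Algebra.Properties.CommutativeMonoid.Sum ℕ.+-0-commutativeMonoid
    using (sum; sum-cong-≗; sum-replicate-zero; ∑-comm; ∑-distrib-+)
  open import Algebra.Properties.Semiring.Sum ℕ.+-*-semiring using (*-distribˡ-sum; *-distribʳ-sum)
  open import Data.Nat.Base
    using (zero; suc; _+_; _*_; _∸_; _≤_; _<_; _≤ᵇ_; z≤n; s≤s; NonZero; >-nonZero; >-nonZero⁻¹)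
  open import Data.Nat.Properties hiding (_≟_)

  private variable
    M : ℕ

  -- Polynomial inequalities between `t`, `c`, `q` and `w`.

  -- In use, p ≤ r is a nonnegative combination of the hypotheses and s the slack
  -- that remains.
  ≤-certificate : ∀ {x y p r} s → p ≤ r → x + r + s ≡ y + p → x ≤ y
  ≤-certificate {x} {y} {p} {r} s p≤r eq = +-cancelʳ-≤ r x y (begin
    x + r     ≤⟨ m≤m+n (x + r) s ⟩
    x + r + s ≡⟨ eq ⟩
    y + p     ≤⟨ +-monoʳ-≤ y p≤r ⟩
    y + r     ∎)
    where open ≤-Reasoning

  -- The slack is `(b - a) * (y - x)`. This lets the certificates multiply two inequalities, such as
  -- `c ≤ t` and `t + c ≤ q`.
  rearrangement : ∀ {a b x y} → a ≤ b → x ≤ y → a * y + b * x ≤ a * x + b * y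
  rearrangement {a} {b} {x} {y} a≤b x≤y with b ∸ a | m+[n∸m]≡n a≤b | y ∸ x | m+[n∸m]≡n x≤y
  ... | d | refl | e | refl = ≤-trans (m≤m+n _ (d * e)) (≤-reflexive (identity a d x e))
    where
    identity : ∀ a d x e → a * (x + e) + (a + d) * x + d * e ≡ a * x + (a + d) * (x + e)
    identity = solve-∀

  module _ {t c q w : ℕ} (t+c≤q : t + c ≤ q) where

    -- The hypothesis reads `w ≥ q * (t - c)`, and `q ≥ t + c` makes this at least
    -- `(t + c) * (t - c)`.
    quadratic-arith : c ≤ t → q * t ≤ w + q * c → t * t ≤ w + c * c
    quadratic-arith c≤t h = ≤-certificate 0 (+-mono-≤ h (rearrangement c≤t t+c≤q)) (identity t c q w)
      where
      identity : ∀ t c q w →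
        t * t + (w + q * c + (c * (t + c) + t * q)) + 0 ≡ w + c * c + (q * t + (c * q + t * (t + c)))
      identity = solve-∀

    module _ .{{_ : NonZero t}} {A : ℕ} (5A≤6t³ : 5 * A ≤ 6 * (t * t * t)) where

      -- In units where `t = 1`: `w ≥ q * (2 - c) - A ≥ (1 + c) * (2 - c) - 6/5 = 4/5 + c - c²`.
      parabola-arith : c ≤ 2 * t → q * (2 * (t * t)) ≤ A + t * w + q * (t * c) →
               4 * (t * t) + 5 * (t * c) ≤ 5 * w + 5 * (c * c)
      parabola-arith c≤2t h = *-cancelˡ-≤ t (≤-certificate 0
        (+-mono-≤ (*-monoʳ-≤ 5 h) (+-mono-≤ 5A≤6t³ (*-monoʳ-≤ (5 * t) (rearrangement c≤2t t+c≤q))))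
        (identity t c q w A))
        where
        identity : ∀ t c q w A →
          t * (4 * (t * t) + 5 * (t * c))
            + (5 * (A + t * w + q * (t * c)) + (6 * (t * t * t) + 5 * t * (c * (t + c) + 2 * t * q))) + 0
          ≡ t * (5 * w + 5 * (c * c))
            + (5 * (q * (2 * (t * t))) + (5 * A + 5 * t * (c * q + 2 * t * (t + c))))
        identity = solve-∀

      -- In units where `t = 1`: `2 * w ≥ (1 + c) * (5 - 2 * c) - 18/5 = 7/5 + c * (3 - 2 * c)`,
      -- whose last term is nonnegative.
      small-c-arith : 2 * c ≤ 3 * t → q * (5 * (t * t)) ≤ 3 * A + 2 * t * w + q * (2 * (t * c)) →
               7 * (t * t) ≤ 10 * w
      small-c-arith 2c≤3t h = *-cancelˡ-≤ t (≤-certificate 0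
        (+-mono-≤ (*-monoʳ-≤ 5 h) (+-mono-≤ (*-monoʳ-≤ 3 5A≤6t³)
          (+-mono-≤ (*-monoʳ-≤ (5 * t) (rearrangement 2c≤5t t+c≤q)) (*-monoʳ-≤ (5 * (t * c)) 2c≤3t))))
        (identity t c q w A))
        where
        2c≤5t : 2 * c ≤ 5 * t
        2c≤5t = ≤-trans 2c≤3t (*-monoˡ-≤ t (m≤n+m 3 2))
        identity : ∀ t c q w A →
          t * (7 * (t * t))
            + (5 * (3 * A + 2 * t * w + q * (2 * (t * c))) + (3 * (6 * (t * t * t))
            + (5 * t * (2 * c * (t + c) + 5 * t * q) + 5 * (t * c) * (3 * t)))) + 0
          ≡ t * (10 * w)
            + (5 * (q * (5 * (t * t))) + (3 * (5 * A)
            + (5 * t * (2 * c * q + 5 * t * (t + c)) + 5 * (t * c) * (2 * c))))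
        identity = solve-∀

      -- In units where `t = 1`: `q ≥ 5/2`, so `7 * w ≥ 35/2 - 12 = 11/2`, and `11/14` exceeds
      -- `7/10`.
      large-c-arith : 3 * t ≤ 2 * c → q * (7 * (t * t)) ≤ 10 * A + 7 * t * w → 7 * (t * t) ≤ 10 * w
      large-c-arith 3t≤2c h = *-cancelˡ-≤ (14 * t) {{m*n≢0 14 t}} (≤-certificate (12 * (t * t * t))
        (+-mono-≤ (*-monoʳ-≤ 20 h) (+-mono-≤ (*-monoʳ-≤ 40 5A≤6t³)
          (+-mono-≤ (*-monoʳ-≤ (140 * (t * t)) t+c≤q) (*-monoʳ-≤ (70 * (t * t)) 3t≤2c))))
        (identity t c q w A))
        where
        identity : ∀ t c q w A →
          14 * t * (7 * (t * t))
            + (20 * (10 * A + 7 * t * w) + (40 * (6 * (t * t * t))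
            + (140 * (t * t) * q + 70 * (t * t) * (2 * c)))) + 12 * (t * t * t)
          ≡ 14 * t * (10 * w)
            + (20 * (q * (7 * (t * t))) + (40 * (5 * A)
            + (140 * (t * t) * (t + c) + 70 * (t * t) * (3 * t))))
        identity = solve-∀

  -- In units where `t = 1`, the line `1 - 2c/3` lies below `1 - c²` for `c ≤ 2/3`, below
  -- `4/5 + c - c²` for `2/3 ≤ c ≤ 3/2`, and is not positive from `3/2` on.
  chord : ∀ {t c w} → (c ≤ t → t * t ≤ w + c * c) →
          (c ≤ 2 * t → 4 * (t * t) + 5 * (t * c) ≤ 5 * w + 5 * (c * c)) →
          3 * (t * t) ≤ 3 * w + 2 * (t * c)
  chord {t} {c} {w} low high with ≤-total (3 * t) (2 * c) | ≤-total (3 * c) (2 * t)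
  ... | inj₁ 3t≤2c | _ = ≤-certificate (3 * w) (*-monoʳ-≤ t 3t≤2c) (identity t c w)
    where
    identity : ∀ t c w → 3 * (t * t) + t * (2 * c) + 3 * w ≡ 3 * w + 2 * (t * c) + t * (3 * t)
    identity = solve-∀
  ... | inj₂ 2c≤3t | inj₁ 3c≤2t = ≤-certificate 0
    (+-mono-≤ (*-monoʳ-≤ 3 (low c≤t)) (*-monoʳ-≤ c 3c≤2t)) (identity t c w)
    where
    c≤t : c ≤ t
    c≤t = *-cancelˡ-≤ 3 (≤-trans 3c≤2t (*-monoˡ-≤ t (n≤1+n 2)))
    identity : ∀ t c w →
      3 * (t * t) + (3 * (w + c * c) + c * (2 * t)) + 0 ≡ 3 * w + 2 * (t * c) + (3 * (t * t) + c * (3 * c))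
    identity = solve-∀
  ... | inj₂ 2c≤3t | inj₂ 2t≤3c = *-cancelˡ-≤ 10 (≤-certificate (t * c)
    (+-mono-≤ (*-monoʳ-≤ 6 (high c≤2t))
      (+-mono-≤ (*-monoʳ-≤ 5 (rearrangement 2t≤3c 2c≤3t)) (*-monoʳ-≤ (8 * t) 2c≤3t)))
    (identity t c w))
    where
    c≤2t : c ≤ 2 * t
    c≤2t = *-cancelˡ-≤ 2 (≤-trans 2c≤3t (≤-trans (*-monoˡ-≤ t (n≤1+n 3)) (≤-reflexive (*-assoc 2 2 t))))
    identity : ∀ t c w →
      10 * (3 * (t * t)) + (6 * (5 * w + 5 * (c * c))
        + (5 * (2 * t * (2 * c) + 3 * c * (3 * t)) + 8 * t * (3 * t))) + t * c
      ≡ 10 * (3 * w + 2 * (t * c)) + (6 * (4 * (t * t) + 5 * (t * c))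
        + (5 * (2 * t * (3 * t) + 3 * c * (2 * c)) + 8 * t * (2 * c)))
    identity = solve-∀

  -- Indicators and sums over finite sets.

  ∧-intro : ∀ {a b} → T a → T b → T (a ∧ b)
  ∧-intro p q = Equivalence.from T-∧ (p , q)

  ∧-elim₁ : ∀ {a b} → T (a ∧ b) → T a
  ∧-elim₁ = proj₁ ∘ Equivalence.to T-∧

  ∧-elim₂ : ∀ {a b} → T (a ∧ b) → T b
  ∧-elim₂ {a} = proj₂ ∘ Equivalence.to (T-∧ {a})

  ι : Bool → ℕ
  ι true  = 1
  ι false = 0

  ι≤ : ∀ {b m} → (T b → 1 ≤ m) → ι b ≤ m
  ι≤ {true}  h = h _
  ι≤ {false} h = z≤n

  1≤ι : ∀ {b} → T b → 1 ≤ ι b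
  1≤ι {true} _ = ≤-refl

  ι-mono : ∀ {a b} → (T a → T b) → ι a ≤ ι b
  ι-mono {a} h = ι≤ {a} (1≤ι ∘ h)

  ι*≤ : ∀ {b k m} → (T b → k ≤ m) → ι b * k ≤ m
  ι*≤ {true}  {k} h = ≤-trans (≤-reflexive (*-identityˡ k)) (h _)
  ι*≤ {false}     h = z≤n

  sum-mono-≤ : ∀ {m} {f g : Fin m → ℕ} → (∀ i → f i ≤ g i) → sum f ≤ sum g
  sum-mono-≤ {zero}  f≤g = z≤n
  sum-mono-≤ {suc m} f≤g = +-mono-≤ (f≤g zero) (sum-mono-≤ (f≤g ∘ suc))

  term≤sum : ∀ {m} (f : Fin m → ℕ) i → f i ≤ sum f
  term≤sum f zero    = m≤m+n _ _
  term≤sum f (suc i) = ≤-trans (term≤sum (f ∘ suc) i) (m≤n+m _ _)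

  size : (Fin M → Bool) → ℕ
  size S = sum (ι ∘ S)

  sumOver : (Fin M → Bool) → (Fin M → ℕ) → ℕ
  sumOver S g = sum (λ z → ι (S z) * g z)

  sumOver-affine : ∀ (S : Fin M → Bool) (g h : Fin M → ℕ) a b {k l} →
    (∀ z → T (S z) → k ≤ a * g z + b * h z + l) →
    size S * k ≤ a * sumOver S g + b * sumOver S h + size S * l
  sumOver-affine S g h a b {k} {l} bound = begin
    size S * k
      ≡⟨ *-distribʳ-sum k (ι ∘ S) ⟩
    sum (λ z → ι (S z) * k)
      ≤⟨ sum-mono-≤ (λ z → pointwise z (S z) (bound z)) ⟩
    sum (λ z → a * (ι (S z) * g z) + b * (ι (S z) * h z) + ι (S z) * l)
      ≡⟨ ∑-distrib-+ (λ z → a * (ι (S z) * g z) + b * (ι (S z) * h z)) (λ z → ι (S z) * l) ⟩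
    sum (λ z → a * (ι (S z) * g z) + b * (ι (S z) * h z)) + sum (λ z → ι (S z) * l)
      ≡⟨ cong₂ _+_ (∑-distrib-+ (λ z → a * (ι (S z) * g z)) (λ z → b * (ι (S z) * h z)))
                   (sym (*-distribʳ-sum l (ι ∘ S))) ⟩
    sum (λ z → a * (ι (S z) * g z)) + sum (λ z → b * (ι (S z) * h z)) + size S * l
      ≡⟨ cong (_+ size S * l) (sym (cong₂ _+_ (*-distribˡ-sum a (λ z → ι (S z) * g z))
                                              (*-distribˡ-sum b (λ z → ι (S z) * h z)))) ⟩
    a * sumOver S g + b * sumOver S h + size S * l ∎
    where
    open ≤-Reasoning
    unit : ∀ a b g h l → a * g + b * h + l ≡ a * (1 * g) + b * (1 * h) + 1 * l
    unit = solve-∀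
    pointwise : ∀ z s → (T s → k ≤ a * g z + b * h z + l) →
                ι s * k ≤ a * (ι s * g z) + b * (ι s * h z) + ι s * l
    pointwise z true  h′ = ≤-trans (≤-reflexive (*-identityˡ k))
      (≤-trans (h′ _) (≤-reflexive (unit a b (g z) (h z) l)))
    pointwise z false h′ = z≤n

  -- Lower bounds for the number of triangles at a vertex.

  -- Here c and w are as at the top, A is the total number of triangles, and the
  -- bound B keeps c and the out-degrees small compared with n.
  module Descent
    (D : Fin M → Fin M → Bool) (c w : Fin M → ℕ)
    (t B A : ℕ) .{{_ : NonZero t}} (2t≤B : 2 * t ≤ B) (5A≤6t³ : 5 * A ≤ 6 * (t * t * t))
    (t+c≤q : ∀ v → t + c v ≤ size (D v))
    (q≤2B⁺ : ∀ {v z} → c v ≤ B → T (D v z) → size (D z) ≤ 2 * B)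
    (excess≤w : ∀ {v} → c v ≤ B → size (D v) ≤ 2 * B → sumOver (D v) (λ z → t + c z ∸ c v) ≤ w v)
    (total : ∀ v → sumOver (D v) w ≤ A)
    where

    private
      excess : Fin M → Fin M → ℕ
      excess v z = t + c z ∸ c v

      -- The averaging step behind all the bounds on `w`. Summed over the out-neighbours of `v`, the
      -- terms `w z` give at most `A` and the terms `excess v z` at most `w v`.
      affine : ∀ {v} → c v ≤ B → size (D v) ≤ 2 * B → ∀ a b {k l} →
               (∀ z → T (D v z) → k ≤ a * w z + b * excess v z + l) →
               size (D v) * k ≤ a * A + b * w v + size (D v) * l
      affine {v} c≤B q≤2B a b bound = ≤-trans
        (sumOver-affine (D v) w (excess v) a b bound)
        (+-monoˡ-≤ _ (+-mono-≤ (*-monoʳ-≤ a (total v)) (*-monoʳ-≤ b (excess≤w c≤B q≤2B))))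

      t+c≤c+excess : ∀ v z → t + c z ≤ c v + excess v z
      t+c≤c+excess v z = m≤n+m∸n (t + c z) (c v)

    quadratic : ∀ {v} → c v ≤ B → size (D v) ≤ 2 * B → c v ≤ t → t * t ≤ w v + c v * c v
    quadratic {v} c≤B q≤2B c≤t = quadratic-arith (t+c≤q v) c≤t
      (subst (λ x → size (D v) * t ≤ x + size (D v) * c v) (*-identityˡ (w v))
        (affine c≤B q≤2B 0 1 λ z _ → begin
          t                        ≤⟨ m≤m+n t (c z) ⟩
          t + c z                  ≤⟨ t+c≤c+excess v z ⟩
          c v + excess v z         ≡⟨ rearrange (c v) (excess v z) ⟩
          1 * excess v z + c v     ∎))
      where
      open ≤-Reasoning
      rearrange : ∀ x y → x + y ≡ 1 * y + x
      rearrange = solve-∀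

    -- The line `t * t - t * c` is the chord of the parabola `t * t - c * c` over `0 ≤ c ≤ t`;
    -- beyond `t` it is not positive.
    below-chord₁ : ∀ {z} → size (D z) ≤ 2 * B → t * t ≤ w z + t * c z
    below-chord₁ {z} q≤2B with ≤-total t (c z)
    ... | inj₁ t≤c = ≤-trans (*-monoʳ-≤ t t≤c) (m≤n+m _ _)
    ... | inj₂ c≤t = ≤-trans
      (quadratic (≤-trans c≤t (≤-trans (m≤m+n t _) 2t≤B)) q≤2B c≤t)
      (+-monoʳ-≤ (w z) (*-monoˡ-≤ (c z) c≤t))

    -- The weights 1 and `t` are chosen so that `c z` cancels: adding `w z ≥ t * t - t * c z` to `t`
    -- times `excess v z ≥ t + c z - c v` leaves `2 * (t * t) - t * c v`.
    parabola : ∀ {v} → c v ≤ B → size (D v) ≤ 2 * B → c v ≤ 2 * t →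
               4 * (t * t) + 5 * (t * c v) ≤ 5 * w v + 5 * (c v * c v)
    parabola {v} c≤B q≤2B c≤2t = parabola-arith (t+c≤q v) {A = A} 5A≤6t³ c≤2t
      (subst (λ x → size (D v) * (2 * (t * t)) ≤ x + t * w v + size (D v) * (t * c v)) (*-identityˡ A)
        (affine c≤B q≤2B 1 t λ z Dvz → ≤-certificate 0
          (+-mono-≤ (below-chord₁ (q≤2B⁺ c≤B Dvz)) (*-monoʳ-≤ t (t+c≤c+excess v z)))
          (identity t (c v) (c z) (w z) (excess v z))))
      where
      identity : ∀ t c c′ w e → 2 * (t * t) + (w + t * c′ + t * (c + e)) + 0
                              ≡ 1 * w + t * e + t * c + (t * t + t * (t + c′))
      identity = solve-∀

    below-chord₂ : ∀ {z} → size (D z) ≤ 2 * B → 3 * (t * t) ≤ 3 * w z + 2 * (t * c z)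
    below-chord₂ {z} q≤2B with ≤-total (c z) B
    ... | inj₁ c≤B = chord (quadratic c≤B q≤2B) (parabola c≤B q≤2B)
    -- The two curves are only available for `c z ≤ B`; beyond, `c z ≥ 2 * t` and the line is
    -- negative.
    ... | inj₂ B≤c = ≤-trans
      (≤-trans (*-monoˡ-≤ (t * t) (n≤1+n 3)) (≤-reflexive (identity t)))
      (≤-trans (*-monoʳ-≤ 2 (*-monoʳ-≤ t (≤-trans 2t≤B B≤c))) (m≤n+m _ (3 * w z)))
      where
      identity : ∀ t → 4 * (t * t) ≡ 2 * (t * (2 * t))
      identity = solve-∀

    -- As for `parabola`, with the steeper line of slope 2/3: the weights 3 and `2 * t` again cancel
    -- `c z`.
    large-if-small-c : ∀ {v} → c v ≤ B → size (D v) ≤ 2 * B → 2 * c v ≤ 3 * t → 7 * (t * t) ≤ 10 * w v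
    large-if-small-c {v} c≤B q≤2B 2c≤3t = small-c-arith (t+c≤q v) {A = A} 5A≤6t³ 2c≤3t
      (affine c≤B q≤2B 3 (2 * t) λ z Dvz → ≤-certificate 0
        (+-mono-≤ (below-chord₂ (q≤2B⁺ c≤B Dvz)) (*-monoʳ-≤ (2 * t) (t+c≤c+excess v z)))
        (identity t (c v) (c z) (w z) (excess v z)))
      where
      identity : ∀ t c c′ w e →
        5 * (t * t) + (3 * w + 2 * (t * c′) + 2 * t * (c + e)) + 0
        ≡ 3 * w + 2 * t * e + 2 * (t * c) + (3 * (t * t) + 2 * t * (t + c′))
      identity = solve-∀

    private
      -- Induction on `c v`, bounded by `k`. When `c v` is large, every out-neighbour `z` satisfies
      -- `10 * w z + 7 * t * excess v z ≥ 7 * (t * t)`: through its first term by induction if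
      -- `c z < c v`, and otherwise through its second, since the excess is then at least `t`.
      large< : ∀ k {v} → c v < k → c v ≤ B → size (D v) ≤ 2 * B → 7 * (t * t) ≤ 10 * w v
      large< (suc k) {v} (s≤s c≤k) c≤B q≤2B with ≤-total (2 * c v) (3 * t)
      ... | inj₁ 2c≤3t = large-if-small-c c≤B q≤2B 2c≤3t
      ... | inj₂ 3t≤2c = large-c-arith (t+c≤q v) {A = A} 5A≤6t³ 3t≤2c
        (subst (size (D v) * (7 * (t * t)) ≤_) (drop-zero (10 * A + 7 * t * w v) (size (D v)))
          (affine c≤B q≤2B 10 (7 * t) bound))
        where
        drop-zero : ∀ x y → x + y * 0 ≡ x
        drop-zero = solve-∀
        bound : ∀ z → T (D v z) → 7 * (t * t) ≤ 10 * w z + 7 * t * excess v z + 0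
        bound z Dvz with <-≤-connex (c z) (c v)
        ... | inj₁ c′<c = ≤-trans
          (large< k (≤-trans c′<c c≤k) (≤-trans (<⇒≤ c′<c) c≤B) (q≤2B⁺ c≤B Dvz))
          (≤-trans (m≤m+n _ _) (m≤m+n _ 0))
        ... | inj₂ c≤c′ = begin
          7 * (t * t)                            ≡⟨ *-assoc 7 t t ⟨
          7 * t * t                              ≤⟨ *-monoʳ-≤ (7 * t) (m+n≤o⇒m≤o∸n t (+-monoʳ-≤ t c≤c′)) ⟩
          7 * t * excess v z                     ≤⟨ m≤n+m _ _ ⟩
          10 * w z + 7 * t * excess v z          ≤⟨ m≤m+n _ 0 ⟩
          10 * w z + 7 * t * excess v z + 0      ∎
          where open ≤-Reasoning

    large : ∀ {v} → c v ≤ B → size (D v) ≤ 2 * B → 7 * (t * t) ≤ 10 * w v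
    large = large< _ ≤-refl

  -- Directed triangles and their restriction to small out-degrees.

  does⁺ : ∀ {j k : Fin 3} → j ≡ k → T (does (j ≟ k))
  does⁺ {j} {k} eq = subst T (sym (dec-true (j ≟ k) eq)) _

  does⁻ : ∀ {j k : Fin 3} → T (does (j ≟ k)) → j ≡ k
  does⁻ {j} {k} p with j ≟ k
  ... | yes eq = eq

  -- For an edge `v → z`, this is the number of directed triangles `v → z → u → v` through it.
  commonOut : (Fin M → Fin M → Bool) → Fin M → Fin M → ℕ
  commonOut D z v = size (λ u → D z u ∧ D u v)

  closed : (Fin M → Fin M → Bool) → Fin M → Fin M → Fin M → Bool
  closed D x y z = D x y ∧ (D y z ∧ D z x)

  cycles : (Fin M → Fin M → Bool) → Fin M → ℕ
  cycles D x = sum (λ y → size (closed D x y))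

  cycles-mono : ∀ (D E : Fin M → Fin M → Bool) → (∀ {u v} → T (D u v) → T (E u v)) →
                ∀ x → cycles D x ≤ cycles E x
  cycles-mono D E D⊆E x = sum-mono-≤ λ y → sum-mono-≤ λ z → ι-mono {closed D x y z} λ p →
    ∧-intro (D⊆E {x} {y} (∧-elim₁ p))
      (∧-intro (D⊆E {y} {z} (∧-elim₁ (∧-elim₂ {D x y} p))) (D⊆E {z} {x} (∧-elim₂ {D y z} (∧-elim₂ {D x y} p))))

  -- Traversing a directed triangle backwards from `x` exchanges its other two vertices.
  cycles-flip : ∀ (D : Fin M → Fin M → Bool) x → cycles (flip D) x ≡ cycles D x
  cycles-flip {M} D x = trans
    (∑-comm (λ y z → ι (closed (flip D) x y z)))
    (sum-cong-≗ {M} λ y → sum-cong-≗ {M} λ z → cong ι (reverse (D z x) (D y z) (D x y)))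
    where
    reverse : ∀ a b c → a ∧ (b ∧ c) ≡ c ∧ (b ∧ a)
    reverse true  true  true  = refl
    reverse true  true  false = refl
    reverse true  false true  = refl
    reverse true  false false = refl
    reverse false true  true  = refl
    reverse false true  false = refl
    reverse false false true  = refl
    reverse false false false = refl

  restrict : ℕ → (Fin M → Fin M → Bool) → Fin M → Fin M → Bool
  restrict K D u v = D u v ∧ ((size (D u) ≤ᵇ K) ∧ (size (D v) ≤ᵇ K))

  restrict⊆ : ∀ K (D : Fin M → Fin M → Bool) {u v} → T (restrict K D u v) → T (D u v)
  restrict⊆ K D {u} {v} = ∧-elim₁ {D u v}

  cycles-restrict-large : ∀ K (D : Fin M → Fin M → Bool) x → K < size (D x) → cycles (restrict K D) x ≤ 0
  cycles-restrict-large {M} K D x K<q = ≤-trans (sum-mono-≤ {M} {g = λ _ → 0} λ y → ≤-trans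
    (sum-mono-≤ {M} {g = λ _ → 0} λ z → ι≤ {closed (restrict K D) x y z} λ p → contradiction
      (≤ᵇ⇒≤ (size (D x)) K (∧-elim₁ (∧-elim₂ {D x y} (∧-elim₁ p)))) (<⇒≱ K<q))
    zeros) zeros
    where
    zeros : sum {M} (λ _ → 0) ≤ 0
    zeros = ≤-reflexive (sum-replicate-zero M)

  -- Directed triangles counted from a colour class.

  module Rotated
    -- `σ` is abstract so that both cyclic orders of the parts are instances; by `reach`, at most
    -- two steps lead from any class to class `zero`.
    (colour : Fin M → Fin 3) (σ : Fin 3 → Fin 3) (σ³ : ∀ j → σ (σ (σ j)) ≡ j)
    (reach : ∀ j → j ≡ zero ⊎ σ j ≡ zero ⊎ σ (σ j) ≡ zero)
    where

    class : Fin 3 → Fin M → Bool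
    class j v = does (colour v ≟ j)

    Steps : (Fin M → Fin M → Bool) → Set
    Steps D = ∀ {u v} → T (D u v) → colour v ≡ σ (colour u)

    total : (Fin M → Fin M → Bool) → Fin 3 → ℕ
    total D j = sumOver (class j) (cycles D)

    module _ (D : Fin M → Fin M → Bool) (steps : Steps D) where

      -- A directed triangle starting at `x` in class `j` also starts at its second vertex, which
      -- lies in class `σ j`.
      total-rotate : ∀ j → total D j ≤ total D (σ j)
      total-rotate j = begin
        sum (λ x → ι (class j x) * cycles D x)
          ≡⟨ sum-cong-≗ {M} (λ x → expand (ι (class j x)) x) ⟩
        sum (λ x → sum λ y → sum λ z → ι (class j x) * ι (closed D x y z))
          ≤⟨ sum-mono-≤ (λ x → sum-mono-≤ λ y → sum-mono-≤ λ z → pointwise x y z) ⟩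
        sum (λ x → sum λ y → sum λ z → ι (class (σ j) y) * ι (closed D y z x))
          ≡⟨ ∑-comm (λ x y → sum λ z → ι (class (σ j) y) * ι (closed D y z x)) ⟩
        sum (λ y → sum λ x → sum λ z → ι (class (σ j) y) * ι (closed D y z x))
          ≡⟨ sum-cong-≗ {M} (λ y → ∑-comm (λ x z → ι (class (σ j) y) * ι (closed D y z x))) ⟩
        sum (λ y → sum λ z → sum λ x → ι (class (σ j) y) * ι (closed D y z x))
          ≡⟨ sum-cong-≗ {M} (λ y → expand (ι (class (σ j) y)) y) ⟨
        sum (λ y → ι (class (σ j) y) * cycles D y) ∎
        where
        open ≤-Reasoning
        expand : ∀ k x → k * cycles D x ≡ sum λ y → sum λ z → k * ι (closed D x y z)
        expand k x = trans (*-distribˡ-sum k (λ y → size (closed D x y)))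
          (sum-cong-≗ {M} λ y → *-distribˡ-sum k (ι ∘ closed D x y))
        pointwise : ∀ x y z → ι (class j x) * ι (closed D x y z) ≤ ι (class (σ j) y) * ι (closed D y z x)
        pointwise x y z = ι*≤ {class j x} λ xj → ι≤ {closed D x y z} λ p →
          *-mono-≤ (1≤ι {class (σ j) y} (does⁺ (trans (steps (∧-elim₁ p)) (cong σ (does⁻ xj)))))
            (1≤ι {closed D y z x} (subst T (rot (D x y) (D y z) (D z x)) p))
          where
          rot : ∀ a b c → a ∧ (b ∧ c) ≡ b ∧ (c ∧ a)
          rot a b c = trans (∧-comm a (b ∧ c)) (∧-assoc b c a)

      total≤total₀ : ∀ j → total D j ≤ total D zero
      total≤total₀ j with reach j
      ... | inj₁ refl = ≤-refl
      ... | inj₂ (inj₁ eq) = subst (λ k → total D j ≤ total D k) eq (total-rotate j)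
      ... | inj₂ (inj₂ eq) = subst (λ k → total D j ≤ total D k) eq
        (≤-trans (total-rotate j) (total-rotate (σ j)))

    -- The out-neighbours of `v` all lie in one class. With `g` counting directed triangles, the sum
    -- is therefore bounded by the total of that class.
    sumOver-step : ∀ {D} → Steps D → ∀ (g : Fin M → ℕ) v →
                   sumOver (D v) g ≤ sumOver (class (σ (colour v))) g
    sumOver-step {D} steps g v = sum-mono-≤ λ z →
      *-monoˡ-≤ (g z) (ι-mono {D v z} λ p → does⁺ (steps p))

    -- The bound for a single orientation.

    module Orientation
      (D : Fin M → Fin M → Bool) (steps : Steps D) (n t : ℕ) .{{_ : NonZero t}}
      (class-size : ∀ j → size (class j) ≡ n)
      (degree : ∀ v → n + t ≤ size (D v) + size (flip D v))
      (B : ℕ) (2t≤B : 2 * t ≤ B) (total≤B : total D zero ≤ B) (B<n : B < n)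
      where

      private
        q c : Fin M → ℕ
        q v = size (D v)
        c v = n ∸ size (flip D v)

      in≤n : ∀ v → size (flip D v) ≤ n
      in≤n v = ≤-trans
        -- As `σ` has order three, the class before that of `v` is obtained by applying `σ` twice.
        (sum-mono-≤ λ u → ι-mono {D u v} λ p → does⁺ (trans (sym (σ³ _)) (cong (λ j → σ (σ j)) (sym (steps p)))))
        (≤-reflexive (class-size (σ (σ (colour v)))))

      c+in≡n : ∀ v → c v + size (flip D v) ≡ n
      c+in≡n v = m∸n+n≡m (in≤n v)

      t+c≤q : ∀ v → t + c v ≤ q v
      t+c≤q v = +-cancelʳ-≤ (size (flip D v)) (t + c v) (q v) (begin
        t + c v + size (flip D v)   ≡⟨ +-assoc t (c v) _ ⟩
        t + (c v + size (flip D v)) ≡⟨ cong (t +_) (c+in≡n v) ⟩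
        t + n                       ≡⟨ +-comm t n ⟩
        n + t                       ≤⟨ degree v ⟩
        q v + size (flip D v)       ∎)
        where open ≤-Reasoning

      -- The out-neighbours of `z` and the in-neighbours of `v` both lie in the class preceding `v`,
      -- of size `n = c v + size (flip D v)`; inclusion and exclusion bounds their overlap from
      -- below.
      q≤c+common : ∀ {v z} → T (D v z) → q z ≤ c v + commonOut D z v
      q≤c+common {v} {z} Dvz = +-cancelʳ-≤ (size (flip D v)) (q z) _ (begin
        q z + size (flip D v)
          ≡⟨ ∑-distrib-+ (λ u → ι (D z u)) (λ u → ι (D u v)) ⟨
        sum (λ u → ι (D z u) + ι (D u v))
          ≤⟨ sum-mono-≤ pointwise ⟩
        sum (λ u → ι (class j u) + ι (D z u ∧ D u v))
          ≡⟨ ∑-distrib-+ (ι ∘ class j) (λ u → ι (D z u ∧ D u v)) ⟩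
        size (class j) + commonOut D z v
          ≡⟨ cong (_+ commonOut D z v) (trans (class-size j) (sym (c+in≡n v))) ⟩
        c v + size (flip D v) + commonOut D z v
          ≡⟨ swapʳ (c v) (size (flip D v)) (commonOut D z v) ⟩
        c v + commonOut D z v + size (flip D v) ∎)
        where
        open ≤-Reasoning
        j = σ (σ (colour v))
        swapʳ : ∀ a b c → a + b + c ≡ a + c + b
        swapʳ = solve-∀
        out∈j : ∀ {u} → T (D z u) → 1 ≤ ι (class j u)
        out∈j {u} Dzu = 1≤ι {class j u} (does⁺ (trans (steps Dzu) (cong σ (steps Dvz))))
        in∈j : ∀ {u} → T (D u v) → 1 ≤ ι (class j u)
        in∈j {u} Duv = 1≤ι {class j u} (does⁺ (trans (sym (σ³ _)) (cong (λ j → σ (σ j)) (sym (steps Duv)))))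
        pointwise : ∀ u → ι (D z u) + ι (D u v) ≤ ι (class j u) + ι (D z u ∧ D u v)
        pointwise u with D z u | D u v | out∈j {u} | in∈j {u}
        ... | true  | true  | h | _ = +-monoˡ-≤ 1 (h _)
        ... | true  | false | h | _ = +-monoˡ-≤ 0 (h _)
        ... | false | true  | _ | h = ≤-trans (h _) (m≤m+n _ 0)
        ... | false | false | _ | _ = z≤n

      excess≤common : ∀ {v z} → T (D v z) → t + c z ∸ c v ≤ commonOut D z v
      excess≤common {v} {z} Dvz = m≤n+o⇒m∸n≤o (t + c z) (c v) (≤-trans (t+c≤q z) (q≤c+common Dvz))

      common≤cycles : ∀ {v z} → T (D v z) → commonOut D z v ≤ cycles D v
      common≤cycles {v} {z} Dvz = ≤-trans
        (sum-mono-≤ λ u → ι-mono {D z u ∧ D u v} (∧-intro Dvz))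
        (term≤sum (λ y → size (closed D v y)) z)

      cycles≤B : ∀ v → cycles D v ≤ B
      cycles≤B v = begin
        cycles D v                                ≡⟨ *-identityˡ _ ⟨
        1 * cycles D v                            ≤⟨ *-monoˡ-≤ (cycles D v) (1≤ι {class (colour v) v} (does⁺ {colour v} refl)) ⟩
        ι (class (colour v) v) * cycles D v       ≤⟨ term≤sum (λ x → ι (class (colour v) x) * cycles D x) v ⟩
        total D (colour v)                        ≤⟨ total≤total₀ D steps (colour v) ⟩
        total D zero                              ≤⟨ total≤B ⟩
        B                                         ∎
        where open ≤-Reasoning

      q≤c+B : ∀ {v z} → T (D v z) → q z ≤ c v + B
      q≤c+B {v} Dvz = ≤-trans (q≤c+common Dvz) (+-monoʳ-≤ (c v) (≤-trans (common≤cycles Dvz) (cycles≤B v)))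

      q≤2B : ∀ {v z} → c v ≤ B → T (D v z) → q z ≤ 2 * B
      q≤2B {v} c≤B Dvz = ≤-trans (q≤c+B Dvz)
        (≤-trans (+-monoˡ-≤ B c≤B) (≤-reflexive (cong (B +_) (sym (+-identityʳ B)))))

      D₃ : Fin M → Fin M → Bool
      D₃ = restrict (3 * B) D

      steps₃ : Steps D₃
      steps₃ {u} p = steps (restrict⊆ (3 * B) D {u} p)

      module _ (5A≤6t³ : 5 * total D₃ zero ≤ 6 * (t * t * t)) where

        -- No triangle `v → z → u → v` is lost in the restriction: `q z ≤ 2 * B` because `c v ≤ B`,
        -- then `c z ≤ q z ≤ 2 * B` gives `q u ≤ c z + B ≤ 3 * B`. This is the origin of the
        -- threshold `3 * B`.
        excess≤cycles₃ : ∀ {v} → c v ≤ B → q v ≤ 2 * B →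
                         sumOver (D v) (λ z → t + c z ∸ c v) ≤ cycles D₃ v
        excess≤cycles₃ {v} c≤B qv≤2B = sum-mono-≤ λ z → ι*≤ {D v z} λ Dvz →
          ≤-trans (excess≤common Dvz) (sum-mono-≤ λ u → ι-mono {D z u ∧ D u v} (inside Dvz))
          where
          2B≤3B : 2 * B ≤ 3 * B
          2B≤3B = *-monoˡ-≤ B (n≤1+n 2)
          low : ∀ {x} → q x ≤ 2 * B → T (q x ≤ᵇ 3 * B)
          low q≤ = ≤⇒≤ᵇ (≤-trans q≤ 2B≤3B)
          inside : ∀ {z u} → T (D v z) → T (D z u ∧ D u v) → T (closed D₃ v z u)
          inside {z} {u} Dvz p =
            ∧-intro (∧-intro Dvz (∧-intro (low qv≤2B) (low qz≤2B)))
              (∧-intro (∧-intro Dzu (∧-intro (low qz≤2B) u₃))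
                       (∧-intro (∧-elim₂ {D z u} p) (∧-intro u₃ (low qv≤2B))))
            where
            Dzu = ∧-elim₁ p
            qz≤2B = q≤2B c≤B Dvz
            u₃ : T (q u ≤ᵇ 3 * B)
            u₃ = ≤⇒≤ᵇ (begin
              q u        ≤⟨ q≤c+B Dzu ⟩
              c z + B    ≤⟨ +-monoˡ-≤ B (≤-trans (m≤n+m (c z) t) (≤-trans (t+c≤q z) qz≤2B)) ⟩
              2 * B + B  ≡⟨ +-comm (2 * B) B ⟩
              3 * B      ∎)
              where open ≤-Reasoning

        -- Out-degrees and excesses are those of `D`, while the weights count only triangles of
        -- `D₃`.
        open Descent D c (cycles D₃) t B (total D₃ zero) 2t≤B 5A≤6t³ t+c≤q q≤2B excess≤cycles₃
          (λ v → ≤-trans (sumOver-step steps (cycles D₃) v) (total≤total₀ D₃ steps₃ _))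

        -- Suppose no directed triangle passes through `v`. If `q v ≤ B`, this contradicts `large`.
        -- Otherwise every out-neighbour has smaller `c`, so by induction each lies in a triangle;
        -- these counts sum to at most `B`, so `q v ≤ B` after all.
        cycles-positive< : ∀ k {v} → c v < k → 1 ≤ cycles D v
        cycles-positive< (suc k) {v} (s≤s c≤k) with cycles D v in eq
        ... | suc _ = s≤s z≤n
        ... | zero with ≤-<-connex (q v) B
        ...   | inj₁ q≤B = contradiction 7t²≤0 (<⇒≱ (*-mono-≤ {1} {7} (s≤s z≤n) (*-mono-≤ 0<t 0<t)))
          where
          0<t : 0 < t
          0<t = >-nonZero⁻¹ t
          7t²≤0 : 7 * (t * t) ≤ 0
          7t²≤0 = ≤-trans
            (large (≤-trans (m≤n+m (c v) t) (≤-trans (t+c≤q v) q≤B)) (≤-trans q≤B (m≤m+n B _)))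
            (*-monoʳ-≤ 10 (subst (cycles D₃ v ≤_) eq (cycles-mono D₃ D (λ {u} → restrict⊆ (3 * B) D {u}) v)))
        ...   | inj₂ B<q = contradiction q≤B (<⇒≱ B<q)
          where
          c-decreases : ∀ {z} → T (D v z) → c z < c v
          c-decreases {z} Dvz = ≰⇒> λ c≤c′ → <⇒≱ (>-nonZero⁻¹ t) (begin
            t                ≤⟨ m+n≤o⇒m≤o∸n t (+-monoʳ-≤ t c≤c′) ⟩
            t + c z ∸ c v    ≤⟨ excess≤common Dvz ⟩
            commonOut D z v  ≤⟨ common≤cycles Dvz ⟩
            cycles D v       ≡⟨ eq ⟩
            0                ∎)
            where open ≤-Reasoning
          q≤B : q v ≤ B
          q≤B = begin
            q v                          ≤⟨ sum-mono-≤ (λ z → ι≤ {D v z} λ Dvz →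
                                              *-mono-≤ (1≤ι {D v z} Dvz)
                                                (cycles-positive< k (≤-trans (c-decreases Dvz) c≤k))) ⟩
            sumOver (D v) (cycles D)     ≤⟨ sumOver-step steps (cycles D) v ⟩
            total D (σ (colour v))       ≤⟨ total≤total₀ D steps _ ⟩
            total D zero                 ≤⟨ total≤B ⟩
            B                            ∎
            where open ≤-Reasoning

        -- Each of the `n` vertices of class `zero` starts a directed triangle.
        too-many-cycles : n ≤ B
        too-many-cycles = begin
          n                ≡⟨ class-size zero ⟨
          size (class zero) ≤⟨ sum-mono-≤ (λ v → ι≤ {class zero v} λ v₀ →
                                *-mono-≤ (1≤ι {class zero v} v₀) (cycles-positive< _ ≤-refl)) ⟩
          total D zero     ≤⟨ total≤B ⟩
          B                ∎
          where open ≤-Reasoning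

      restricted-total : 6 * (t * t * t) ≤ 5 * total D₃ zero
      restricted-total = ≮⇒≥ λ 5A<6t³ → <⇒≱ B<n (too-many-cycles (<⇒≤ 5A<6t³))

  -- Combining the two orientations.

  rot rot⁻¹ : Fin 3 → Fin 3
  rot zero             = suc zero
  rot (suc zero)       = suc (suc zero)
  rot (suc (suc zero)) = zero
  rot⁻¹ = rot ∘ rot

  rot³ : ∀ j → rot (rot (rot j)) ≡ j
  rot³ zero             = refl
  rot³ (suc zero)       = refl
  rot³ (suc (suc zero)) = refl

  rot⁻³ : ∀ j → rot⁻¹ (rot⁻¹ (rot⁻¹ j)) ≡ j
  rot⁻³ j = trans (rot³ (rot (rot (rot j)))) (rot³ j)

  rot-reach : ∀ j → j ≡ zero ⊎ rot j ≡ zero ⊎ rot (rot j) ≡ zero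
  rot-reach zero             = inj₁ refl
  rot-reach (suc zero)       = inj₂ (inj₂ refl)
  rot-reach (suc (suc zero)) = inj₂ (inj₁ refl)

  rot⁻¹-reach : ∀ j → j ≡ zero ⊎ rot⁻¹ j ≡ zero ⊎ rot⁻¹ (rot⁻¹ j) ≡ zero
  rot⁻¹-reach zero             = inj₁ refl
  rot⁻¹-reach (suc zero)       = inj₂ (inj₁ refl)
  rot⁻¹-reach (suc (suc zero)) = inj₂ (inj₂ refl)

  module _ (colour : Fin M → Fin 3) where

    open Rotated colour rot rot³ rot-reach using (class; total; Steps; module Orientation)
    private module Reversed = Rotated colour rot⁻¹ rot⁻³ rot⁻¹-reach

    cycle-bound : ∀ (D : Fin M → Fin M → Bool) → Steps D → ∀ n t .{{_ : NonZero t}} →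
      (∀ j → size (class j) ≡ n) →
      (∀ v → n + t ≤ size (D v) + size (flip D v)) →
      18 * (t * t * t) ≤ n →
      12 * (t * t * t) ≤ 5 * total D zero
    -- Arguing by contradiction supplies the upper bound on the total that `Orientation` requires.
    cycle-bound D steps n t class-size degree 18t³≤n = ≮⇒≥ λ few → <⇒≱ few (enough few)
      where
      t³ = t * t * t
      -- The assumption `few` gives `5 * total D zero < 12 * t³ ≤ 5 * B`. The factor 18 in the bound
      -- on `n` is that of `3 * B + 3 * B`.
      B = 3 * t³

      0<t : 0 < t
      0<t = >-nonZero⁻¹ t

      1≤t² : 1 ≤ t * t
      1≤t² = *-mono-≤ 0<t 0<t

      t≤t³ : t ≤ t³
      t≤t³ = ≤-trans (≤-reflexive (sym (*-identityˡ t))) (*-monoˡ-≤ t 1≤t²)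

      2t≤B : 2 * t ≤ B
      2t≤B = *-mono-≤ (n≤1+n 2) t≤t³

      B<n : B < n
      B<n = ≤-trans (*-monoˡ-< t³ {{>-nonZero (≤-trans 0<t t≤t³)}} {3} {18} (m≤m+n 4 14)) 18t³≤n

      total₃ total₃⁻¹ : Fin 3 → ℕ
      total₃   = total (restrict (3 * B) D)
      total₃⁻¹ = total (restrict (3 * B) (flip D))

      -- The out-degree and in-degree of `x` add up to at least `n + t > 6 * B`, so one of them
      -- exceeds `3 * B` and the corresponding restricted count at `x` vanishes.
      disjoint : total₃ zero + total₃⁻¹ zero ≤ total D zero
      disjoint = begin
        total₃ zero + total₃⁻¹ zero
          ≡⟨ ∑-distrib-+ (λ x → ι (class zero x) * cycles (restrict (3 * B) D) x)
                         (λ x → ι (class zero x) * cycles (restrict (3 * B) (flip D)) x) ⟨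
        sum (λ x → ι (class zero x) * cycles (restrict (3 * B) D) x
                 + ι (class zero x) * cycles (restrict (3 * B) (flip D)) x)
          ≡⟨ sum-cong-≗ {M} (λ x → sym (*-distribˡ-+ (ι (class zero x)) (cycles (restrict (3 * B) D) x) _)) ⟩
        sum (λ x → ι (class zero x) * (cycles (restrict (3 * B) D) x + cycles (restrict (3 * B) (flip D)) x))
          ≤⟨ sum-mono-≤ (λ x → *-monoʳ-≤ (ι (class zero x)) (pointwise x)) ⟩
        total D zero ∎
        where
        open ≤-Reasoning
        forwards : ∀ x → cycles (restrict (3 * B) D) x ≤ cycles D x
        forwards = cycles-mono (restrict (3 * B) D) D (λ {u} → restrict⊆ (3 * B) D {u})
        backwards : ∀ x → cycles (restrict (3 * B) (flip D)) x ≤ cycles D x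
        backwards x = ≤-trans
          (cycles-mono (restrict (3 * B) (flip D)) (flip D) (λ {u} → restrict⊆ (3 * B) (flip D) {u}) x)
          (≤-reflexive (cycles-flip D x))
        both-small : ∀ x → size (D x) ≤ 3 * B → size (flip D x) ≤ 3 * B → n + t ≤ n
        both-small x q≤ q′≤ = begin
          n + t                       ≤⟨ degree x ⟩
          size (D x) + size (flip D x) ≤⟨ +-mono-≤ q≤ q′≤ ⟩
          3 * B + 3 * B               ≡⟨ identity t³ ⟩
          18 * t³                     ≤⟨ 18t³≤n ⟩
          n                           ∎
          where
          identity : ∀ s → 3 * (3 * s) + 3 * (3 * s) ≡ 18 * s
          identity = solve-∀
        pointwise : ∀ x → cycles (restrict (3 * B) D) x + cycles (restrict (3 * B) (flip D)) x ≤ cycles D x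
        pointwise x with ≤-<-connex (size (D x)) (3 * B)
        ... | inj₂ large = +-mono-≤ (cycles-restrict-large (3 * B) D x large) (backwards x)
        ... | inj₁ small = ≤-trans
          (+-mono-≤ (forwards x) (cycles-restrict-large (3 * B) (flip D) x
            (≰⇒> λ small′ → <⇒≱ (m<m+n n 0<t) (both-small x small small′))))
          (≤-reflexive (+-identityʳ _))

      enough : 5 * total D zero < 12 * t³ → 12 * t³ ≤ 5 * total D zero
      enough few = begin
        12 * t³                                    ≡⟨ identity t³ ⟩
        6 * t³ + 6 * t³                            ≤⟨ +-mono-≤ Forward.restricted-total Backward.restricted-total ⟩
        5 * total₃ zero + 5 * total₃⁻¹ zero        ≡⟨ *-distribˡ-+ 5 (total₃ zero) _ ⟨
        5 * (total₃ zero + total₃⁻¹ zero)          ≤⟨ *-monoʳ-≤ 5 disjoint ⟩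
        5 * total D zero                           ∎
        where
        open ≤-Reasoning
        identity : ∀ s → 12 * s ≡ 6 * s + 6 * s
        identity = solve-∀
        total≤B : total D zero ≤ B
        total≤B = *-cancelˡ-≤ 5 (≤-trans (<⇒≤ few)
          (≤-trans (*-monoˡ-≤ t³ (m≤m+n 12 3)) (≤-reflexive (*-assoc 5 3 t³))))
        steps⁻¹ : Reversed.Steps (flip D)
        steps⁻¹ {u} p = trans (sym (rot³ _)) (cong (λ j → rot (rot j)) (sym (steps p)))
        total-flip : total (flip D) zero ≡ total D zero
        total-flip = sum-cong-≗ {M} λ x → cong (ι (class zero x) *_) (cycles-flip D x)
        module Forward = Orientation D steps n t class-size degree B 2t≤B total≤B B<n
        module Backward = Reversed.Orientation (flip D) steps⁻¹ n t class-size
          (λ v → ≤-trans (degree v) (≤-reflexive (+-comm (size (D v)) _)))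
          B 2t≤B (≤-trans (≤-reflexive total-flip) total≤B) B<n

  -- Degrees, triangle counts and part sizes as sums.

  ∣tabulate∣ : ∀ {m} (g : Fin m → Bool) → ∣ tabulate g ∣ ≡ size g
  ∣tabulate∣ {zero}  g = refl
  ∣tabulate∣ {suc m} g with g zero
  ... | true  = cong suc (∣tabulate∣ (g ∘ suc))
  ... | false = ∣tabulate∣ (g ∘ suc)

  δ≤degree : ∀ {N} (G : Graph N) v → δ G ≤ degree G v
  δ≤degree {N} G v = All.tabulate⁻ (All.map⁻ (min≤xs N (List.map (degree G) (allFin N)))) v

  length-filter-map : ∀ {A B : Set} {P : Pred B 0ℓ} (P? : Decidable P) (g : A → B) xs →
    length (filter P? (List.map g xs)) ≡ length (filter (P? ∘ g) xs)
  length-filter-map P? g []       = refl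
  length-filter-map P? g (x ∷ xs) with does (P? (g x))
  ... | true  = cong suc (length-filter-map P? g xs)
  ... | false = length-filter-map P? g xs

  module _ {A : Set} where

    length-filter-tabulate : ∀ {m} {P : Pred A 0ℓ} (P? : Decidable P) (g : Fin m → A) →
      length (filter P? (List.tabulate g)) ≡ size (does ∘ P? ∘ g)
    length-filter-tabulate {zero}  P? g = refl
    length-filter-tabulate {suc m} P? g with does (P? (g zero))
    ... | true  = cong suc (length-filter-tabulate P? (g ∘ suc))
    ... | false = length-filter-tabulate P? (g ∘ suc)

    length-filter-cartesianProduct : ∀ {m} {B : Set} {P : Pred (A × B) 0ℓ} (P? : Decidable P)
      (g : Fin m → A) (ys : List B) →
      length (filter P? (cartesianProduct (List.tabulate g) ys)) ≡ sum (λ i → length (filter (P? ∘ (g i ,_)) ys))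
    length-filter-cartesianProduct {zero}  P? g ys = refl
    length-filter-cartesianProduct {suc m} P? g ys = begin
      length (filter P? (List.map (g zero ,_) ys ++ rest))
        ≡⟨ cong length (filter-++ P? (List.map (g zero ,_) ys) rest) ⟩
      length (filter P? (List.map (g zero ,_) ys) ++ filter P? rest)
        ≡⟨ length-++ (filter P? (List.map (g zero ,_) ys)) ⟩
      length (filter P? (List.map (g zero ,_) ys)) + length (filter P? rest)
        ≡⟨ cong₂ _+_ (length-filter-map P? (g zero ,_) ys)
                     (length-filter-cartesianProduct P? (g ∘ suc) ys) ⟩
      sum (λ i → length (filter (P? ∘ (g i ,_)) ys)) ∎
      where
      open ≡-Reasoning
      rest = cartesianProduct (List.tabulate (g ∘ suc)) ys

  τ-sum : ∀ {N} (G : Graph N) →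
    τ G ≡ sum λ u → sum λ v → size λ w → does (isTriangle? G (u , v , w))
  τ-sum {N} G = begin
    τ G
      ≡⟨ length-filter-cartesianProduct (isTriangle? G) id (cartesianProduct (allFin N) (allFin N)) ⟩
    sum (λ u → length (filter (isTriangle? G ∘ (u ,_)) (cartesianProduct (allFin N) (allFin N))))
      ≡⟨ sum-cong-≗ {N} (λ u → length-filter-cartesianProduct (isTriangle? G ∘ (u ,_)) id (allFin N)) ⟩
    sum (λ u → sum λ v → length (filter (λ w → isTriangle? G (u , v , w)) (allFin N)))
      ≡⟨ sum-cong-≗ {N} (λ u → sum-cong-≗ {N} λ v →
           length-filter-tabulate (λ w → isTriangle? G (u , v , w)) id) ⟩
    sum (λ u → sum λ v → size λ w → does (isTriangle? G (u , v , w))) ∎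
    where open ≡-Reasoning

  sum-↑ : ∀ a {b} (g : Fin (a + b) → ℕ) → sum g ≡ sum (g ∘ (_↑ˡ b)) + sum (g ∘ (a ↑ʳ_))
  sum-↑ zero    g = refl
  sum-↑ (suc a) g = trans (cong (g zero +_) (sum-↑ a (g ∘ suc))) (sym (+-assoc (g zero) _ _))

  sum-const : ∀ m k → sum {m} (λ _ → k) ≡ k * m
  sum-const zero    k = sym (*-zeroʳ k)
  sum-const (suc m) k = trans (cong (k +_) (sum-const m k)) (sym (*-suc k m))

  sum-quotient : ∀ k n (h : Fin k → ℕ) → sum (h ∘ quotient {k} n) ≡ sum h * n
  sum-quotient zero    n h = refl
  sum-quotient (suc k) n h = begin
    sum (h ∘ quotient {suc k} n)
      ≡⟨ sum-↑ n (h ∘ quotient {suc k} n) ⟩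
    sum (h ∘ quotient {suc k} n ∘ (_↑ˡ (k * n))) + sum (h ∘ quotient {suc k} n ∘ (n ↑ʳ_))
      ≡⟨ cong₂ _+_ (sum-cong-≗ (cong h ∘ left)) (sum-cong-≗ (cong h ∘ right)) ⟩
    sum {n} (λ _ → h zero) + sum (h ∘ suc ∘ quotient {k} n)
      ≡⟨ cong₂ _+_ (sum-const n (h zero)) (sum-quotient k n (h ∘ suc)) ⟩
    h zero * n + sum (h ∘ suc) * n
      ≡⟨ *-distribʳ-+ n (h zero) _ ⟨
    sum h * n ∎
    where
    open ≡-Reasoning
    left : ∀ i → quotient {suc k} n (i ↑ˡ (k * n)) ≡ zero
    left i rewrite splitAt-↑ˡ n i (k * n) = refl
    right : ∀ i → quotient {suc k} n (n ↑ʳ i) ≡ suc (quotient {k} n i)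
    right i rewrite splitAt-↑ʳ n (k * n) i = refl

  quotient-reflects-< : ∀ {m} n {i j : Fin (m * n)} → quotient {m} n i Fin.< quotient n j → i Fin.< j
  quotient-reflects-< {m} n {i} {j} lt = subst₂ Fin._<_ (combine-remQuot {m} n i) (combine-remQuot {m} n j)
    (combine-monoˡ-< (remainder {m} n i) (remainder {m} n j) lt)

  size-part : ∀ n j → size {3 * n} (λ v → does (part {n} v ≟ j)) ≡ n
  size-part n j = trans (sum-quotient 3 n (λ i → ι (does (i ≟ j)))) (trans (cong (_* n) (single j)) (*-identityˡ n))
    where
    single : ∀ (j : Fin 3) → size (λ i → does (i ≟ j)) ≡ 1
    single zero             = refl
    single (suc zero)       = refl
    single (suc (suc zero)) = refl

  adjacent-parts : ∀ (i j : Fin 3) → i ≢ j → j ≡ rot i ⊎ i ≡ rot j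
  adjacent-parts zero             zero             i≢j = contradiction refl i≢j
  adjacent-parts zero             (suc zero)       i≢j = inj₁ refl
  adjacent-parts zero             (suc (suc zero)) i≢j = inj₂ refl
  adjacent-parts (suc zero)       zero             i≢j = inj₂ refl
  adjacent-parts (suc zero)       (suc zero)       i≢j = contradiction refl i≢j
  adjacent-parts (suc zero)       (suc (suc zero)) i≢j = inj₁ refl
  adjacent-parts (suc (suc zero)) zero             i≢j = inj₁ refl
  adjacent-parts (suc (suc zero)) (suc zero)       i≢j = inj₂ refl
  adjacent-parts (suc (suc zero)) (suc (suc zero)) i≢j = contradiction refl i≢j

  -- From a tripartite graph to its orientation.

  module _ {n : ℕ} (G : 𝒢₃ n) where

    open 𝒢₃ G using (adj; ~-sym; independent)
    open Rotated (part {n}) rot rot³ rot-reach using (total; class)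

    orient : Fin (3 * n) → Fin (3 * n) → Bool
    orient u v = adj u v ∧ does (part {n} v ≟ rot (part {n} u))

    orient-step : ∀ {u v} → T (orient u v) → part {n} v ≡ rot (part {n} u)
    orient-step {u} {v} p = does⁻ (∧-elim₂ {adj u v} p)

    -- A neighbour lies in another part, hence in the next or the previous one.
    degree≤orient : ∀ v → degree (graph G) v ≤ size (orient v) + size (flip orient v)
    degree≤orient v = begin
      degree (graph G) v                                ≡⟨ ∣tabulate∣ (adj v) ⟩
      size (adj v)                                      ≤⟨ sum-mono-≤ (λ u → ι≤ {adj v u} (split u)) ⟩
      sum (λ u → ι (orient v u) + ι (orient u v))       ≡⟨ ∑-distrib-+ (ι ∘ orient v) (ι ∘ flip orient v) ⟩
      size (orient v) + size (flip orient v)            ∎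
      where
      open ≤-Reasoning
      split : ∀ u → T (adj v u) → 1 ≤ ι (orient v u) + ι (orient u v)
      split u v~u with adjacent-parts (part {n} v) (part {n} u) (independent v~u)
      ... | inj₁ eq = ≤-trans (1≤ι {orient v u} (∧-intro v~u (does⁺ eq))) (m≤m+n _ _)
      ... | inj₂ eq = ≤-trans (1≤ι {orient u v} (∧-intro (~-sym v~u) (does⁺ eq))) (m≤n+m _ _)

    -- A directed triangle starting in part 0 visits parts 0, 1, 2 in turn. The parts are
    -- consecutive blocks, so its vertices are already in the increasing order that `IsTriangle`
    -- demands.
    total≤τ : total orient zero ≤ τ (graph G)
    total≤τ = begin
      total orient zero
        ≡⟨ sum-cong-≗ (λ u → trans (*-distribˡ-sum (ι (class zero u)) (λ v → size (closed orient u v)))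
             (sum-cong-≗ λ v → *-distribˡ-sum (ι (class zero u)) (ι ∘ closed orient u v))) ⟩
      sum (λ u → sum λ v → sum λ w → ι (class zero u) * ι (closed orient u v w))
        ≤⟨ sum-mono-≤ (λ u → sum-mono-≤ λ v → sum-mono-≤ λ w →
             ι*≤ {class zero u} λ u₀ → ι-mono {closed orient u v w} (triangle u v w u₀)) ⟩
      sum (λ u → sum λ v → size λ w → does (isTriangle? (graph G) (u , v , w)))
        ≡⟨ τ-sum (graph G) ⟨
      τ (graph G) ∎
      where
      open ≤-Reasoning
      triangle : ∀ u v w → T (class zero u) → T (closed orient u v w) →
                 T (does (isTriangle? (graph G) (u , v , w)))
      triangle u v w u₀ p = subst T (sym (dec-true (isTriangle? (graph G) (u , v , w))
        ( (increasing (subst₂ Fin._<_ (sym part-u) (sym part-v) (s≤s z≤n))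
          , increasing (subst₂ Fin._<_ (sym part-v) (sym part-w) (s≤s (s≤s z≤n))))
        , (∧-elim₁ u→v , ∧-elim₁ v→w , ~-sym (∧-elim₁ w→u))))) _
        where
        increasing : ∀ {i j : Fin (3 * n)} → part {n} i Fin.< part {n} j → i Fin.< j
        increasing = quotient-reflects-< {3} n
        u→v : T (orient u v)
        u→v = ∧-elim₁ p
        v→w : T (orient v w)
        v→w = ∧-elim₁ (∧-elim₂ {orient u v} p)
        w→u : T (orient w u)
        w→u = ∧-elim₂ {orient v w} (∧-elim₂ {orient u v} p)
        part-u : part {n} u ≡ zero
        part-u = does⁻ u₀
        part-v : part {n} v ≡ suc zero
        part-v = trans (orient-step {u} u→v) (cong rot part-u)
        part-w : part {n} w ≡ suc (suc zero)
        part-w = trans (orient-step {v} v→w) (cong rot part-v)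

    τ-bound : ∀ t .{{_ : NonZero t}} → 18 * (t * t * t) ≤ n → n + t ≤ δ (graph G) →
              12 * (t * t * t) ≤ 5 * τ (graph G)
    τ-bound t 18t³≤n n+t≤δ = ≤-trans
      (cycle-bound (part {n}) orient (λ {u} → orient-step {u}) n t (size-part n)
        (λ v → ≤-trans n+t≤δ (≤-trans (δ≤degree (graph G) v) (degree≤orient v))) 18t³≤n)
      (*-monoʳ-≤ 5 total≤τ)

  -- Passing to the minimum `f`.

  f-bound : ∀ t n .{{_ : NonZero t}} → 18 * t ^ 6 ≤ n → 12 * t ^ 3 ≤ 5 * f n t
  f-bound t n 18t⁶≤n = bound (f-isMin t≤n)
    -- Only for `t ≤ n` is `f n t` the minimum rather than the conventional value 0.
    where
    t≤n : t ≤ n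
    t≤n = begin
      t           ≡⟨ ^-identityʳ t ⟨
      t ^ 1       ≤⟨ ^-monoʳ-≤ t {1} {6} (s≤s z≤n) ⟩
      t ^ 6       ≤⟨ m≤m+n (t ^ 6) _ ⟩
      18 * t ^ 6  ≤⟨ 18t⁶≤n ⟩
      n           ∎
      where open ≤-Reasoning
    cube : t * t * t ≡ t ^ 3
    cube = trans (*-assoc t t t) (cong (λ x → t * (t * x)) (sym (*-identityʳ t)))
    18t³≤n : 18 * (t * t * t) ≤ n
    18t³≤n = begin
      18 * (t * t * t)  ≡⟨ cong (18 *_) cube ⟩
      18 * t ^ 3        ≤⟨ *-monoʳ-≤ 18 (^-monoʳ-≤ t {3} {6} (m≤m+n 3 3)) ⟩
      18 * t ^ 6        ≤⟨ 18t⁶≤n ⟩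
      n                 ∎
      where open ≤-Reasoning
    bound : IsMinTriangleCount n t (f n t) → 12 * t ^ 3 ≤ 5 * f n t
    bound ((G , n+t≤δ , τ≡f) , _) = subst₂ (λ x y → 12 * x ≤ 5 * y) cube τ≡f (τ-bound G t 18t³≤n n+t≤δ)

open import Data.Integer.Base using (+_)
open import Data.Rational.Unnormalised.Base using (_/_; _*_; _≤_; *≤*)

theorem1p4 : (t n : ℕ) → 2 ℕ.≤ t → 18 ℕ.* t ^ 6 ℕ.≤ n → (+ 12 / 5) * (+ (t ^ 3) / 1) ≤ + f n t / 1
-- Cross-multiplying the fractions leaves `12 * t ^ 3 ≤ 5 * f n t`.
theorem1p4 t n 2≤t 18t⁶≤n = *≤* (subst₂ ℤ._≤_
  (trans (ℤ.pos-* 12 (t ^ 3)) (sym (ℤ.*-identityʳ _)))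
  (trans (cong +_ (ℕ.*-comm 5 (f n t))) (ℤ.pos-* (f n t) 5))
  (ℤ.+≤+ (f-bound t n {{ℕ.>-nonZero (ℕ.≤-trans (ℕ.s≤s ℕ.z≤n) 2≤t)}} 18t⁶≤n)))
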